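{- Let $n\ge 2$ be an integer, and let $x_1,x_2,\ldots,x_n$ and $g$ be real numbers such that $x_1\le x_2\le\ldots\le x_n$ and $g>0$. Let $(a_1,a_2,\ldots,a_{2n})=(x_1,x_1+g,x_2,x_2+g,\ldots,x_n,x_n+g)$, that is, $a_{2i-1}=x_i$ and $a_{2i}=x_i+g$ for $1\le i\le n$, and let $\pi$ be a permutation of $\{1,\ldots,2n\}$ such that $b_1\le b_2\le\ldots\le b_{2n}$, where $b_i=a_{\pi(i)}$ for $1\le i\le 2n$. Put $$R=\sum_{i=1}^n b_{2i},\qquad U=\sum_{i=1}^n b_{2i-1},\qquad G=\min\{x_{i+1}-x_i\mid 1\le i\le n-1\}.$$ Then $R-U\le ng$, with equality if and only if $G\ge g$. -}

module Defs where

open import Algebra.Bundles.Raw using (RawMonoid)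
open import Data.Fin.Base using (Fin; combine; zero; suc; inject₁; toℕ)
open import Data.Integer.Base using (+_)
import Data.Integer.Solver as ℤSolver
open import Data.Nat.Base as ℕ using (ℕ; suc; s≤s)
open import Data.Product.Base using (∃)
open import Data.Rational.Base as ℚ using (ℚ; 0ℚ; ∣_∣; toℚᵘ)
import Data.Rational.Properties as ℚ
open import Data.Rational.Solver using (module +-*-Solver)
open import Data.Rational.Unnormalised.Base as ℚᵘ using (mkℚᵘ; *≡*)
import Data.Rational.Unnormalised.Properties as ℚᵘ
open import Data.Sum.Base using (inj₁; inj₂)
open import Data.Vec.Functional using (Vector; _∷_; []; head; tail; foldr; concat)
open import Level using (0ℓ)
open import Relation.Binary.PropositionalEquality

ε : ℕ → ℚ
ε n = + 1 ℚ./ suc n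

0≤ε : ∀ n → 0ℚ ℚ.≤ ε n
0≤ε n = ℚ.nonNegative⁻¹ (ε n) {{ℚ.normalize-nonNeg 1 (suc n)}}

toℚᵘ-ε : ∀ n → toℚᵘ (ε n) ℚᵘ.≃ mkℚᵘ (+ 1) n
toℚᵘ-ε n = ℚ.toℚᵘ-fromℚᵘ (mkℚᵘ (+ 1) n)

odd : ℕ → ℕ
odd k = suc (k ℕ.+ k)

ε-odd : ∀ k → ε (odd k) ℚ.+ ε (odd k) ≡ ε k
ε-odd k = ℚ.toℚᵘ-injective
  (ℚᵘ.≃-trans (ℚ.toℚᵘ-homo-+ (ε (odd k)) (ε (odd k)))
  (ℚᵘ.≃-trans (ℚᵘ.+-cong (toℚᵘ-ε (odd k)) (toℚᵘ-ε (odd k)))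
  (ℚᵘ.≃-trans (*≡* (identity (+ k))) (ℚᵘ.≃-sym (toℚᵘ-ε k)))))
  where
  open ℤSolver.+-*-Solver
  identity = solve 1
    (λ k → let s = con (+ 2) :+ (k :+ k) in
      (con (+ 1) :* s :+ con (+ 1) :* s) :* (con (+ 1) :+ k) := con (+ 1) :* (s :* s))
    refl

p≤∣p∣ : ∀ p → p ℚ.≤ ∣ p ∣
p≤∣p∣ p with ℚ.≤-total 0ℚ p
... | inj₁ 0≤p = ℚ.≤-reflexive (sym (ℚ.0≤p⇒∣p∣≡p 0≤p))
... | inj₂ p≤0 = ℚ.≤-trans p≤0 (ℚ.0≤∣p∣ p)

∣p-q∣≡∣q-p∣ : ∀ p q → ∣ p ℚ.- q ∣ ≡ ∣ q ℚ.- p ∣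
∣p-q∣≡∣q-p∣ p q = trans (cong ∣_∣ (solve 2 (λ p q → p :- q := :- (q :- p)) refl p q))
                        (ℚ.∣-p∣≡∣p∣ (q ℚ.- p))
  where
  open +-*-Solver

∣-∣-upper : ∀ p q {e} → ∣ p ℚ.- q ∣ ℚ.≤ e → p ℚ.≤ q ℚ.+ e
∣-∣-upper p q {e} d = begin
  p                    ≡⟨ solve 2 (λ p q → p := q :+ (p :- q)) refl p q ⟩
  q ℚ.+ (p ℚ.- q)      ≤⟨ ℚ.+-monoʳ-≤ q (p≤∣p∣ (p ℚ.- q)) ⟩
  q ℚ.+ ∣ p ℚ.- q ∣    ≤⟨ ℚ.+-monoʳ-≤ q d ⟩
  q ℚ.+ e              ∎
  where
  open ℚ.≤-Reasoning
  open +-*-Solver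

upper-- : ∀ p q {e} → p ℚ.≤ q ℚ.+ e → p ℚ.- q ℚ.≤ e
upper-- p q {e} h = begin
  p ℚ.- q          ≤⟨ ℚ.+-monoˡ-≤ (ℚ.- q) h ⟩
  q ℚ.+ e ℚ.- q    ≡⟨ solve 2 (λ q e → (q :+ e) :- q := e) refl q e ⟩
  e                ∎
  where
  open ℚ.≤-Reasoning
  open +-*-Solver

∣-∣-intro : ∀ p q {e} → p ℚ.≤ q ℚ.+ e → q ℚ.≤ p ℚ.+ e → ∣ p ℚ.- q ∣ ℚ.≤ e
∣-∣-intro p q {e} h k with ℚ.∣p∣≡p∨∣p∣≡-p (p ℚ.- q)
... | inj₁ eq = subst (ℚ._≤ e) (sym eq) (upper-- p q h)
... | inj₂ eq = subst (ℚ._≤ e)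
  (sym (trans eq (solve 2 (λ p q → :- (p :- q) := q :- p) refl p q))) (upper-- q p k)
  where
  open +-*-Solver

⊓-upper : ∀ p q r s {e} → p ℚ.≤ r ℚ.+ e → q ℚ.≤ s ℚ.+ e → p ℚ.⊓ q ℚ.≤ r ℚ.⊓ s ℚ.+ e
⊓-upper p q r s {e} h k with ℚ.⊓-sel r s
... | inj₁ eq = subst (λ t → p ℚ.⊓ q ℚ.≤ t ℚ.+ e) (sym eq) (ℚ.≤-trans (ℚ.p⊓q≤p p q) h)
... | inj₂ eq = subst (λ t → p ℚ.⊓ q ℚ.≤ t ℚ.+ e) (sym eq) (ℚ.≤-trans (ℚ.p⊓q≤q p q) k)

∣-∣-⊓ : ∀ p q r s {e} → ∣ p ℚ.- r ∣ ℚ.≤ e → ∣ q ℚ.- s ∣ ℚ.≤ e →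
        ∣ p ℚ.⊓ q ℚ.- r ℚ.⊓ s ∣ ℚ.≤ e
∣-∣-⊓ p q r s {e} h k = ∣-∣-intro (p ℚ.⊓ q) (r ℚ.⊓ s)
  (⊓-upper p q r s (∣-∣-upper p r h) (∣-∣-upper q s k))
  (⊓-upper r s p q (∣-∣-upper r p (flipped p r h)) (∣-∣-upper s q (flipped q s k)))
  where
  flipped : ∀ a b → ∣ a ℚ.- b ∣ ℚ.≤ e → ∣ b ℚ.- a ∣ ℚ.≤ e
  flipped a b = subst (ℚ._≤ e) (∣p-q∣≡∣q-p∣ a b)

-- Bishop's real numbers, with indices shifted by one: seq n is within 1/(n+1)
-- of the real it represents.  Equality of reals is _≈_, not _≡_.  Eta is
-- off so that conversion checking does not compare the regularity proofs.

record ℝ : Set where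
  no-eta-equality
  constructor mkℝ
  field
    seq     : ℕ → ℚ
    regular : ∀ m n → ∣ seq m ℚ.- seq n ∣ ℚ.≤ ε m ℚ.+ ε n

open ℝ public

infix  4 _≈_ _≤_ _≥_ _<_
infixl 6 _+_ _-_
infixl 7 _⊓_
infix  8 -_

_≈_ : ℝ → ℝ → Set
x ≈ y = ∀ n → ∣ seq x n ℚ.- seq y n ∣ ℚ.≤ ε n ℚ.+ ε n

_≤_ : ℝ → ℝ → Set
x ≤ y = ∀ n → seq x n ℚ.- seq y n ℚ.≤ ε n ℚ.+ ε n

_≥_ : ℝ → ℝ → Set
x ≥ y = y ≤ x

_<_ : ℝ → ℝ → Set
x < y = ∃ λ n → ε n ℚ.+ ε n ℚ.< seq y n ℚ.- seq x n

0ℝ : ℝ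
0ℝ .seq _ = 0ℚ
0ℝ .regular m n = ℚ.+-mono-≤ (0≤ε m) (0≤ε n)

-- The sum samples its arguments at 2n+1, where each is within 1/(2n+2).
_+_ : ℝ → ℝ → ℝ
(x + y) .seq n = seq x (odd n) ℚ.+ seq y (odd n)
(x + y) .regular m n = begin
  ∣ (a ℚ.+ b) ℚ.- (c ℚ.+ d) ∣
    ≡⟨ cong ∣_∣ (solve 4 (λ a b c d → (a :+ b) :- (c :+ d) := (a :- c) :+ (b :- d)) refl a b c d) ⟩
  ∣ (a ℚ.- c) ℚ.+ (b ℚ.- d) ∣
    ≤⟨ ℚ.∣p+q∣≤∣p∣+∣q∣ (a ℚ.- c) (b ℚ.- d) ⟩
  ∣ a ℚ.- c ∣ ℚ.+ ∣ b ℚ.- d ∣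
    ≤⟨ ℚ.+-mono-≤ (regular x (odd m) (odd n)) (regular y (odd m) (odd n)) ⟩
  (e ℚ.+ f) ℚ.+ (e ℚ.+ f)
    ≡⟨ solve 2 (λ e f → (e :+ f) :+ (e :+ f) := (e :+ e) :+ (f :+ f)) refl e f ⟩
  (e ℚ.+ e) ℚ.+ (f ℚ.+ f)
    ≡⟨ cong₂ ℚ._+_ (ε-odd m) (ε-odd n) ⟩
  ε m ℚ.+ ε n ∎
  where
  open ℚ.≤-Reasoning
  open +-*-Solver
  a = seq x (odd m)
  b = seq y (odd m)
  c = seq x (odd n)
  d = seq y (odd n)
  e = ε (odd m)
  f = ε (odd n)

-_ : ℝ → ℝ
(- x) .seq n = ℚ.- seq x n
(- x) .regular m n = begin
  ∣ ℚ.- p ℚ.- ℚ.- q ∣    ≡⟨ cong ∣_∣ (solve 2 (λ p q → (:- p) :- (:- q) := :- (p :- q)) refl p q) ⟩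
  ∣ ℚ.- (p ℚ.- q) ∣      ≡⟨ ℚ.∣-p∣≡∣p∣ (p ℚ.- q) ⟩
  ∣ p ℚ.- q ∣            ≤⟨ regular x m n ⟩
  ε m ℚ.+ ε n            ∎
  where
  open ℚ.≤-Reasoning
  open +-*-Solver
  p = seq x m
  q = seq x n

_-_ : ℝ → ℝ → ℝ
x - y = x + (- y)

_⊓_ : ℝ → ℝ → ℝ
(x ⊓ y) .seq n = seq x n ℚ.⊓ seq y n
(x ⊓ y) .regular m n =
  ∣-∣-⊓ (seq x m) (seq y m) (seq x n) (seq y n) (regular x m n) (regular y m n)

+-0-rawMonoid : RawMonoid 0ℓ 0ℓ
+-0-rawMonoid = record { Carrier = ℝ ; _≈_ = _≈_ ; _∙_ = _+_ ; ε = 0ℝ }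

-- n · x is the sum of n copies of x.
open import Algebra.Definitions.RawMonoid +-0-rawMonoid public
  using (sum) renaming (_×_ to _·_)

Ascending : ∀ {n} → Vector ℝ n → Set
Ascending {n} v = ∀ (i j : Fin n) → toℕ j ≡ suc (toℕ i) → v i ≤ v j

minimum : ∀ {n} → Vector ℝ (suc n) → ℝ
minimum v = foldr _⊓_ (head v) (tail v)

minGap : ∀ {n} → 2 ℕ.≤ n → Vector ℝ n → ℝ
minGap (s≤s (s≤s _)) x = minimum (λ i → x (suc i) - x (inject₁ i))

interleave : ∀ {n} → Vector ℝ n → ℝ → Vector ℝ (n ℕ.* 2)
interleave x g = concat (λ i → x i ∷ x i + g ∷ [])

-- Here positions count from 1: b₁, b₃, …, b₂ₙ₋₁ and b₂, b₄, …, b₂ₙ.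
oddEntries evenEntries : ∀ n → Vector ℝ (n ℕ.* 2) → Vector ℝ n
oddEntries  n b i = b (combine i (zero {1}))
evenEntries n b i = b (combine i (suc (zero {0})))

module Submission where

open import Algebra.Bundles using (AbelianGroup)
import Algebra.Consequences.Setoid as Consequences
open import Data.Fin.Base as Fin using (Fin; zero; suc; combine; inject₁; toℕ)
open import Data.Fin.Permutation using (Permutation′; _⟨$⟩ʳ_; flip; inverseʳ)
import Data.Fin.Properties as Fin
open import Data.Integer.Base using (+[1+_])
import Data.Integer.Properties as ℤ
open import Data.Nat.Base as ℕ using (ℕ; suc; z≤n; s≤s)
import Data.Nat.Properties as ℕ
open import Data.Product.Base using (_×_; _,_; proj₁; proj₂; uncurry)
open import Data.Rational.Base as ℚ using (mkℚ; 0ℚ; ∣_∣)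
import Data.Rational.Properties as ℚ
open import Data.Rational.Solver using (module +-*-Solver)
open import Data.Rational.Unnormalised.Base using (*≤*)
import Data.Rational.Unnormalised.Properties as ℚᵘ
open import Data.Sum.Base using (inj₁; inj₂)
open import Data.Vec.Functional using (Vector; _∷_; []; concat; foldr; rearrange; head; tail; replicate)
open import Function.Base using (_∘_)
open import Function.Bundles using (_⇔_; mk⇔; Equivalence; Injection)
open import Function.Properties.Inverse using (↔⇒↣)
open import Level as Level using (Level; _⊔_; 0ℓ)
open import Relation.Binary.Bundles using (Poset; Setoid)
open import Relation.Binary.Core using (Rel)
open import Relation.Binary.Lattice using (Infimum)
open import Relation.Binary.PropositionalEquality as ≡ using (_≡_)
open import Relation.Binary.Structures using (IsEquivalence; IsPartialOrder)
open import Relation.Nullary.Decidable.Core using (yes; no)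
open import Relation.Nullary.Negation using (¬_; contradiction)

-- Write lower = (b₁, b₃, …) and upper = (b₂, b₄, …).  By pigeonhole a sorted
-- rearrangement b of a inherits every sorted lower or upper bound of a, so
-- comparing a with (x₁, x₁, x₂, x₂, …) and (x₁+g, x₁+g, x₂+g, x₂+g, …) gives
-- xᵢ ≤ lowerᵢ and upperᵢ ≤ xᵢ + g, hence upperᵢ ≤ lowerᵢ + g; sum over i.
-- Equality of the sums forces lowerᵢ + g ≤ upperᵢ for each i, whence
-- xᵢ + 2g ≤ lowerᵢ + 2g ≤ upperᵢ + g ≤ lowerᵢ₊₁ + g ≤ upperᵢ₊₁ ≤ xᵢ₊₁ + g.
-- Conversely, if all gaps are at least g then a is itself sorted and bounds b
-- from both sides.  No step compares two reals, so all of this is constructive.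

private
  variable
    a ℓ : Level
    A : Set a
    n : ℕ

concat-combine : ∀ {m} (v : Vector (Vector A m) n) i j → concat v (combine i j) ≡ v i j
concat-combine v i j = ≡.cong (uncurry v) (Fin.remQuot-combine i j)

pairs : Vector A n → Vector A n → Vector A (n ℕ.* 2)
pairs u v = concat (λ i → u i ∷ v i ∷ [])

pairs-all : (P : A → Set ℓ) (u v : Vector A n) → (∀ i → P (u i)) → (∀ i → P (v i)) →
            ∀ m → P (pairs u v m)
pairs-all {n = suc n} P u v Pu Pv zero          = Pu zero
pairs-all {n = suc n} P u v Pu Pv (suc zero)    = Pv zero
pairs-all {n = suc n} P u v Pu Pv (suc (suc m)) = pairs-all P (tail u) (tail v) (Pu ∘ suc) (Pv ∘ suc) m

pairs-rel : (_∼_ : Rel A ℓ) {u u′ v v′ : Vector A n} →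
            (∀ i → u i ∼ u′ i) → (∀ i → v i ∼ v′ i) → ∀ m → pairs u v m ∼ pairs u′ v′ m
pairs-rel {n = suc n} _∼_ u∼ v∼ zero          = u∼ zero
pairs-rel {n = suc n} _∼_ u∼ v∼ (suc zero)    = v∼ zero
pairs-rel {n = suc n} _∼_ u∼ v∼ (suc (suc m)) = pairs-rel _∼_ (u∼ ∘ suc) (v∼ ∘ suc) m

module Sorted {c ℓ₁ ℓ₂} (P : Poset c ℓ₁ ℓ₂) where

  open Poset P

  Monotone : Vector Carrier n → Set ℓ₂
  Monotone v = ∀ {i j} → i Fin.≤ j → v i ≤ v j

  successive⇒monotone : (v : Vector Carrier n) →
                        (∀ i j → toℕ j ≡ suc (toℕ i) → v i ≤ v j) →
                        Monotone v
  successive⇒monotone v step {zero}  {zero}        _         = refl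
  successive⇒monotone v step {zero}  {suc zero}    _         = step zero (suc zero) ≡.refl
  successive⇒monotone v step {zero}  {suc (suc j)} _         =
    trans (step zero (suc zero) ≡.refl)
          (successive⇒monotone (tail v) (λ i k eq → step (suc i) (suc k) (≡.cong suc eq)) {zero} {suc j} z≤n)
  successive⇒monotone v step {suc i} {suc j}       (s≤s i≤j) =
    successive⇒monotone (tail v) (λ i k eq → step (suc i) (suc k) (≡.cong suc eq)) i≤j

  pairs-monotone : (u v : Vector Carrier n) → (∀ i → u i ≤ v i) → (∀ {i j} → i Fin.< j → v i ≤ u j) →
                   Monotone (pairs u v)
  pairs-monotone {n = suc n} u v u≤v v≤u = mono
    where
    v₀≤tail : ∀ m → v zero ≤ pairs (tail u) (tail v) m
    v₀≤tail = pairs-all (v zero ≤_) (tail u) (tail v)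
      (λ i → v≤u ℕ.z<s) (λ i → trans (v≤u ℕ.z<s) (u≤v (suc i)))

    mono : Monotone (pairs u v)
    mono {zero}        {zero}        _               = refl
    mono {zero}        {suc zero}    _               = u≤v zero
    mono {zero}        {suc (suc j)} _               = trans (u≤v zero) (v₀≤tail j)
    mono {suc zero}    {suc zero}    _               = refl
    mono {suc zero}    {suc (suc j)} _               = v₀≤tail j
    mono {suc (suc i)} {suc zero}    (s≤s ())
    mono {suc (suc i)} {suc (suc j)} (s≤s (s≤s i≤j)) =
      pairs-monotone (tail u) (tail v) (u≤v ∘ suc) (v≤u ∘ s≤s) i≤j

  module _ (π : Permutation′ n) {a : Vector Carrier n}
           (b-monotone : Monotone (rearrange (π ⟨$⟩ʳ_) a))
           {c : Vector Carrier n} (c-monotone : Monotone c) where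

    -- Some j ≤ k has k ≤ π j, since π cannot map the k + 1 positions up to k
    -- injectively into the k positions below k.
    rearrange-lower : (∀ m → c m ≤ a m) → ∀ k → c k ≤ a (π ⟨$⟩ʳ k)
    rearrange-lower c≤a k with j , j≤k , k≤πj ← Fin.injective⇒existsPivot (Injection.injective (↔⇒↣ π)) k =
      trans (c-monotone k≤πj) (trans (c≤a (π ⟨$⟩ʳ j)) (b-monotone j≤k))

    rearrange-upper : (∀ m → a m ≤ c m) → ∀ k → a (π ⟨$⟩ʳ k) ≤ c k
    rearrange-upper a≤c k
      with j , j≤k , k≤π⁻¹j ← Fin.injective⇒existsPivot (Injection.injective (↔⇒↣ (flip π))) k =
      trans (b-monotone k≤π⁻¹j)
        (trans (reflexive (Eq.reflexive (≡.cong a (inverseʳ π)))) (trans (a≤c j) (c-monotone j≤k)))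

  module _ {_∧_ : Carrier → Carrier → Carrier} (infimum : Infimum _≤_ _∧_) where

    ≤-foldr⇔ : ∀ {z w} (v : Vector Carrier n) → (z ≤ foldr _∧_ w v) ⇔ (z ≤ w × ∀ i → z ≤ v i)
    ≤-foldr⇔ v = mk⇔ (to v) (λ (z≤w , z≤v) → from v z≤w z≤v)
      where
      to : ∀ {n z w} (v : Vector Carrier n) → z ≤ foldr _∧_ w v → z ≤ w × ∀ i → z ≤ v i
      to {ℕ.zero} v z≤ = z≤ , λ ()
      to {suc n} {z} {w} v z≤
        with h≤ , t≤ , _ ← infimum (head v) (foldr _∧_ w (tail v))
        with z≤w , z≤t ← to (tail v) (trans z≤ t≤) =
        z≤w , λ { zero → trans z≤ h≤ ; (suc i) → z≤t i }

      from : ∀ {n z w} (v : Vector Carrier n) → z ≤ w → (∀ i → z ≤ v i) → z ≤ foldr _∧_ w v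
      from {ℕ.zero} v z≤w z≤v = z≤w
      from {suc n} v z≤w z≤v =
        proj₂ (proj₂ (infimum _ _)) _ (z≤v zero) (from (tail v) z≤w (z≤v ∘ suc))

record OrderedAbelianGroup c ℓ₁ ℓ₂ : Set (Level.suc (c ⊔ ℓ₁ ⊔ ℓ₂)) where
  infix 4 _≤_
  field
    abelianGroup : AbelianGroup c ℓ₁

  open AbelianGroup abelianGroup public
    using (Carrier; _≈_; commutativeMonoid; rawMonoid)
    renaming ( _∙_ to infixl 6 _+_; ε to 0#; _⁻¹ to infix 8 -_; _-_ to infixl 6 _-_
             ; comm to +-comm; identityʳ to +-identityʳ; ∙-congˡ to +-congˡ )

  field
    _≤_            : Rel Carrier ℓ₂
    isPartialOrder : IsPartialOrder _≈_ _≤_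
    +-mono-≤       : ∀ {x y z w} → x ≤ y → z ≤ w → x + z ≤ y + w

  poset : Poset c ℓ₁ ℓ₂
  poset = record { isPartialOrder = isPartialOrder }

module OrderedGroup {c ℓ₁ ℓ₂} (G : OrderedAbelianGroup c ℓ₁ ℓ₂) where

  open OrderedAbelianGroup G
  open import Algebra.Definitions.RawMonoid rawMonoid using (sum) renaming (_×_ to _·_)
  open import Algebra.Properties.AbelianGroup abelianGroup using (//-rightDividesˡ; //-rightDividesʳ)
  open import Algebra.Properties.CommutativeMonoid.Sum commutativeMonoid using (∑-distrib-+; sum-replicate)

  open Poset poset using (refl; trans; reflexive; module Eq)
  open Sorted poset
  open import Relation.Binary.Reasoning.PartialOrder poset

  +-cancelʳ-≤ : ∀ z {x y} → x + z ≤ y + z → x ≤ y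
  +-cancelʳ-≤ z {x} {y} x+z≤y+z = begin
    x            ≈⟨ //-rightDividesʳ z x ⟨
    x + z - z    ≤⟨ +-mono-≤ x+z≤y+z refl ⟩
    y + z - z    ≈⟨ //-rightDividesʳ z y ⟩
    y            ∎

  +-cancelˡ-≤ : ∀ z {x y} → z + x ≤ z + y → x ≤ y
  +-cancelˡ-≤ z {x} {y} z+x≤z+y = +-cancelʳ-≤ z (begin
    x + z    ≈⟨ +-comm x z ⟩
    z + x    ≤⟨ z+x≤z+y ⟩
    z + y    ≈⟨ +-comm z y ⟩
    y + z    ∎)

  x-y≤z⇔x≤y+z : ∀ x y z → (x - y ≤ z) ⇔ (x ≤ y + z)
  x-y≤z⇔x≤y+z x y z = mk⇔
    (λ x-y≤z → begin
      x            ≈⟨ //-rightDividesˡ y x ⟨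
      x - y + y    ≤⟨ +-mono-≤ x-y≤z refl ⟩
      z + y        ≈⟨ +-comm z y ⟩
      y + z        ∎)
    (λ x≤y+z → +-cancelʳ-≤ y (begin
      x - y + y    ≈⟨ //-rightDividesˡ y x ⟩
      x            ≤⟨ x≤y+z ⟩
      y + z        ≈⟨ +-comm y z ⟩
      z + y        ∎))

  z≤x-y⇔y+z≤x : ∀ x y z → (z ≤ x - y) ⇔ (y + z ≤ x)
  z≤x-y⇔y+z≤x x y z = mk⇔
    (λ z≤x-y → begin
      y + z        ≈⟨ +-comm y z ⟩
      z + y        ≤⟨ +-mono-≤ z≤x-y refl ⟩
      x - y + y    ≈⟨ //-rightDividesˡ y x ⟩
      x            ∎)
    (λ y+z≤x → +-cancelʳ-≤ y (begin
      z + y        ≈⟨ +-comm z y ⟩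
      y + z        ≤⟨ y+z≤x ⟩
      x            ≈⟨ //-rightDividesˡ y x ⟨
      x - y + y    ∎))

  sum-mono-≤ : {u v : Vector Carrier n} → (∀ i → u i ≤ v i) → sum u ≤ sum v
  sum-mono-≤ {n = ℕ.zero} u≤v = refl
  sum-mono-≤ {n = suc n}  u≤v = +-mono-≤ (u≤v zero) (sum-mono-≤ (u≤v ∘ suc))

  sum-tight : (u v : Vector Carrier n) → (∀ i → u i ≤ v i) → sum v ≤ sum u → ∀ i → v i ≤ u i
  sum-tight {n = suc n} u v u≤v ∑v≤∑u zero = +-cancelʳ-≤ (sum (tail v))
    (trans ∑v≤∑u (+-mono-≤ refl (sum-mono-≤ (u≤v ∘ suc))))
  sum-tight {n = suc n} u v u≤v ∑v≤∑u (suc i) = sum-tight (tail u) (tail v) (u≤v ∘ suc)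
    (+-cancelˡ-≤ (head v) (trans ∑v≤∑u (+-mono-≤ (u≤v zero) refl))) i

  sum-+-const : (v : Vector Carrier n) (g : Carrier) → sum (λ i → v i + g) ≈ sum v + n · g
  sum-+-const {n} v g = Eq.trans (∑-distrib-+ v (replicate n g)) (+-congˡ (sum-replicate n))

  module _ (x : Vector Carrier (suc n)) (x-monotone : Monotone x) {g : Carrier} (0≤g : 0# ≤ g)
           (π : Permutation′ (suc n ℕ.* 2)) where

    y : Vector Carrier (suc n)
    y i = x i + g

    b : Vector Carrier (suc n ℕ.* 2)
    b = rearrange (π ⟨$⟩ʳ_) (pairs x y)

    lower upper : Vector Carrier (suc n)
    lower i = b (combine i (zero {1}))
    upper i = b (combine i (suc (zero {0})))

    module _ (b-monotone : Monotone b) where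

      x≤y : ∀ i → x i ≤ y i
      x≤y i = begin
        x i         ≈⟨ +-identityʳ (x i) ⟨
        x i + 0#    ≤⟨ +-mono-≤ refl 0≤g ⟩
        x i + g     ∎

      duplicated : (v : Vector Carrier (suc n)) → Monotone v → Monotone (pairs v v)
      duplicated v v-monotone = pairs-monotone v v (λ _ → refl) (v-monotone ∘ ℕ.<⇒≤)

      x≤lower : ∀ i → x i ≤ lower i
      x≤lower i = begin
        x i                          ≡⟨ concat-combine (λ i → x i ∷ x i ∷ []) i zero ⟨
        pairs x x (combine i zero)   ≤⟨ rearrange-lower π {pairs x y} b-monotone (duplicated x x-monotone)
                                          (pairs-rel _≤_ {x} {x} {x} {y} (λ _ → refl) x≤y) (combine i zero) ⟩
        lower i                      ∎

      upper≤y : ∀ i → upper i ≤ y i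
      upper≤y i = begin
        upper i                            ≤⟨ rearrange-upper π {pairs x y} b-monotone
                                                (duplicated y (λ i≤j → +-mono-≤ (x-monotone i≤j) refl))
                                                (pairs-rel _≤_ {x} {y} {y} {y} x≤y (λ _ → refl)) (combine i (suc zero)) ⟩
        pairs y y (combine i (suc zero))   ≡⟨ concat-combine (λ i → y i ∷ y i ∷ []) i (suc zero) ⟩
        y i                                ∎

      upper≤lower+g : ∀ i → upper i ≤ lower i + g
      upper≤lower+g i = trans (upper≤y i) (+-mono-≤ (x≤lower i) refl)

      ∑upper≤∑lower+ng : sum upper ≤ sum lower + suc n · g
      ∑upper≤∑lower+ng = trans (sum-mono-≤ upper≤lower+g) (reflexive (sum-+-const lower g))

      tight⇒separated : sum lower + suc n · g ≤ sum upper → ∀ k → x (inject₁ k) + g ≤ x (suc k)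
      tight⇒separated tight k = +-cancelʳ-≤ g (begin
        x (inject₁ k) + g + g        ≤⟨ +-mono-≤ (+-mono-≤ (x≤lower (inject₁ k)) refl) refl ⟩
        lower (inject₁ k) + g + g    ≤⟨ +-mono-≤ (lower+g≤upper (inject₁ k)) refl ⟩
        upper (inject₁ k) + g        ≤⟨ +-mono-≤ (b-monotone (ℕ.<⇒≤ (Fin.combine-monoˡ-< (suc zero) zero
                                          (ℕ.≤-reflexive (≡.cong ℕ.suc (Fin.toℕ-inject₁ k)))))) refl ⟩
        lower (suc k) + g            ≤⟨ lower+g≤upper (suc k) ⟩
        upper (suc k)                ≤⟨ upper≤y (suc k) ⟩
        x (suc k) + g                ∎)
        where
        lower+g≤upper : ∀ i → lower i + g ≤ upper i
        lower+g≤upper = sum-tight upper (λ i → lower i + g) upper≤lower+g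
          (trans (reflexive (sum-+-const lower g)) tight)

      separated⇒tight : (∀ k → x (inject₁ k) + g ≤ x (suc k)) → sum lower + suc n · g ≤ sum upper
      separated⇒tight separated = trans (reflexive (Eq.sym (sum-+-const lower g))) (sum-mono-≤ lower+g≤upper)
        where
        y≤x : ∀ {i j} → i Fin.< j → y i ≤ x j
        y≤x {i} {suc j} (s≤s i≤j) = begin
          x i + g              ≤⟨ +-mono-≤ (x-monotone (≡.subst (toℕ i ℕ.≤_) (≡.sym (Fin.toℕ-inject₁ j)) i≤j)) refl ⟩
          x (inject₁ j) + g    ≤⟨ separated j ⟩
          x (suc j)            ∎

        a-monotone : Monotone (pairs x y)
        a-monotone = pairs-monotone x y x≤y y≤x

        lower+g≤upper : ∀ i → lower i + g ≤ upper i
        lower+g≤upper i = begin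
          lower i + g                           ≤⟨ +-mono-≤ (rearrange-upper π {pairs x y} b-monotone a-monotone
                                                     (λ _ → refl) (combine i zero)) refl ⟩
          pairs x y (combine i zero) + g        ≡⟨ ≡.cong (_+ g) (concat-combine (λ i → x i ∷ y i ∷ []) i zero) ⟩
          y i                                   ≡⟨ concat-combine (λ i → x i ∷ y i ∷ []) i (suc zero) ⟨
          pairs x y (combine i (suc zero))      ≤⟨ rearrange-lower π {pairs x y} b-monotone a-monotone
                                                     (λ _ → refl) (combine i (suc zero)) ⟩
          upper i                               ∎

open import Defs

positive≰ε : ∀ p → .{{ℚ.Positive p}} → ¬ (∀ k → p ℚ.≤ ε k)
positive≰ε p@(mkℚ +[1+ a ] d _) p≤ε = contradiction 1+a*2+d≤1+d (ℕ.<⇒≱ 1+d<1+a*2+d)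
  where
  1+a*2+d≤1+d : suc a ℕ.* suc (suc d) ℕ.≤ 1 ℕ.* suc d
  1+a*2+d≤1+d with *≤* h ← ℚᵘ.≤-respʳ-≃ (toℚᵘ-ε (suc d)) (ℚ.toℚᵘ-mono-≤ (p≤ε (suc d))) =
    ℤ.drop‿+≤+ h
  1+d<1+a*2+d : 1 ℕ.* suc d ℕ.< suc a ℕ.* suc (suc d)
  1+d<1+a*2+d = begin-strict
    1 ℕ.* suc d            ≡⟨ ℕ.*-identityˡ (suc d) ⟩
    suc d                  <⟨ ℕ.n<1+n (suc d) ⟩
    suc (suc d)            ≤⟨ ℕ.m≤n*m (suc (suc d)) (suc a) ⟩
    suc a ℕ.* suc (suc d)  ∎
    where open ℕ.≤-Reasoning

archimedean : ∀ p q → (∀ k → p ℚ.≤ q ℚ.+ ε k) → p ℚ.≤ q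
archimedean p q p≤q+ε with p ℚ.≤? q
... | yes p≤q = p≤q
... | no  p≰q = contradiction (λ k → upper-- p q (p≤q+ε k)) (positive≰ε (p ℚ.- q) {{ℚ.positive 0<p-q}})
  where
  0<p-q : 0ℚ ℚ.< p ℚ.- q
  0<p-q = ≡.subst (ℚ._< p ℚ.- q) (ℚ.+-inverseʳ q) (ℚ.+-monoˡ-< (ℚ.- q) (ℚ.≰⇒> p≰q))

ε-odd≤ε : ∀ n → ε (odd n) ℚ.≤ ε n
ε-odd≤ε n = begin
  ε (odd n)                  ≡⟨ ℚ.+-identityʳ (ε (odd n)) ⟨
  ε (odd n) ℚ.+ 0ℚ           ≤⟨ ℚ.+-monoʳ-≤ (ε (odd n)) (0≤ε (odd n)) ⟩
  ε (odd n) ℚ.+ ε (odd n)    ≡⟨ ε-odd n ⟩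
  ε n                        ∎
  where open ℚ.≤-Reasoning

0≤ε+ε : ∀ n → 0ℚ ℚ.≤ ε n ℚ.+ ε n
0≤ε+ε n = ℚ.+-mono-≤ (0≤ε n) (0≤ε n)

seq-upper : ∀ x m n → seq x m ℚ.- seq x n ℚ.≤ ε m ℚ.+ ε n
seq-upper x m n = ℚ.≤-trans (p≤∣p∣ (seq x m ℚ.- seq x n)) (regular x m n)

-- Implicit real arguments are given by hand from here on: _≤_ and _≈_ unfold to
-- statements about seq, from which Agda cannot recover the reals.
≤-reflexive : ∀ {x y} → x ≈ y → x ≤ y
≤-reflexive {x} {y} x≈y n = ℚ.≤-trans (p≤∣p∣ (seq x n ℚ.- seq y n)) (x≈y n)

≤-antisym : ∀ {x y} → x ≤ y → y ≤ x → x ≈ y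
≤-antisym {x} {y} x≤y y≤x n = ∣-∣-intro (seq x n) (seq y n) (shift x y (x≤y n)) (shift y x (y≤x n))
  where
  shift : ∀ x y → seq x n ℚ.- seq y n ℚ.≤ ε n ℚ.+ ε n → seq x n ℚ.≤ seq y n ℚ.+ (ε n ℚ.+ ε n)
  shift x y h = begin
    seq x n                              ≡⟨ solve 2 (λ p q → p := q :+ (p :- q)) ≡.refl (seq x n) (seq y n) ⟩
    seq y n ℚ.+ (seq x n ℚ.- seq y n)    ≤⟨ ℚ.+-monoʳ-≤ (seq y n) h ⟩
    seq y n ℚ.+ (ε n ℚ.+ ε n)            ∎
    where
    open ℚ.≤-Reasoning
    open +-*-Solver

-- Passing through index m costs an extra 6 ε m, which ε k = 8 ε m absorbs.
≤-trans : ∀ {x y z} → x ≤ y → y ≤ z → x ≤ z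
≤-trans {x} {y} {z} x≤y y≤z n = archimedean _ _ λ k →
  let m = odd (odd (odd k))
      e = ε m
      p = seq x n ; p′ = seq x m ; q = seq y m ; r′ = seq z m ; r = seq z n
  in begin
  p ℚ.- r
    ≡⟨ solve 5 (λ p p′ q r′ r → p :- r := ((p :- p′) :+ (p′ :- q)) :+ ((q :- r′) :+ (r′ :- r)))
         ≡.refl p p′ q r′ r ⟩
  ((p ℚ.- p′) ℚ.+ (p′ ℚ.- q)) ℚ.+ ((q ℚ.- r′) ℚ.+ (r′ ℚ.- r))
    ≤⟨ ℚ.+-mono-≤ (ℚ.+-mono-≤ (seq-upper x n m) (x≤y m)) (ℚ.+-mono-≤ (y≤z m) (seq-upper z m n)) ⟩
  ((ε n ℚ.+ e) ℚ.+ (e ℚ.+ e)) ℚ.+ ((e ℚ.+ e) ℚ.+ (e ℚ.+ ε n))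
    ≡⟨ solve 2 (λ d e → ((d :+ e) :+ (e :+ e)) :+ ((e :+ e) :+ (e :+ d))
                  := (d :+ d) :+ (((e :+ e) :+ (e :+ e)) :+ (e :+ e))) ≡.refl (ε n) e ⟩
  (ε n ℚ.+ ε n) ℚ.+ (((e ℚ.+ e) ℚ.+ (e ℚ.+ e)) ℚ.+ (e ℚ.+ e))
    ≡⟨ ≡.cong (λ d → (ε n ℚ.+ ε n) ℚ.+ ((d ℚ.+ d) ℚ.+ d)) (ε-odd (odd (odd k))) ⟩
  (ε n ℚ.+ ε n) ℚ.+ ((ε (odd (odd k)) ℚ.+ ε (odd (odd k))) ℚ.+ ε (odd (odd k)))
    ≤⟨ ℚ.+-monoʳ-≤ (ε n ℚ.+ ε n) (ℚ.+-mono-≤ (ℚ.≤-reflexive (ε-odd (odd k))) (ε-odd≤ε (odd k))) ⟩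
  (ε n ℚ.+ ε n) ℚ.+ (ε (odd k) ℚ.+ ε (odd k))
    ≡⟨ ≡.cong ((ε n ℚ.+ ε n) ℚ.+_) (ε-odd k) ⟩
  (ε n ℚ.+ ε n) ℚ.+ ε k ∎
  where
  open ℚ.≤-Reasoning
  open +-*-Solver

seq-≡⇒≈ : ∀ {x y} → (∀ n → seq x n ≡ seq y n) → x ≈ y
seq-≡⇒≈ {x} {y} x≡y n = begin
  ∣ seq x n ℚ.- seq y n ∣    ≡⟨ ≡.cong (λ p → ∣ p ℚ.- seq y n ∣) (x≡y n) ⟩
  ∣ seq y n ℚ.- seq y n ∣    ≡⟨ ≡.cong ∣_∣ (ℚ.+-inverseʳ (seq y n)) ⟩
  0ℚ                         ≤⟨ 0≤ε+ε n ⟩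
  ε n ℚ.+ ε n                ∎
  where open ℚ.≤-Reasoning

≈-sym : ∀ {x y} → x ≈ y → y ≈ x
≈-sym {x} {y} x≈y n = ≡.subst (ℚ._≤ ε n ℚ.+ ε n) (∣p-q∣≡∣q-p∣ (seq x n) (seq y n)) (x≈y n)

≈-isEquivalence : IsEquivalence _≈_
≈-isEquivalence = record
  { refl  = λ {x} → seq-≡⇒≈ {x} {x} λ _ → ≡.refl
  ; sym   = λ {x} {y} → ≈-sym {x} {y}
  ; trans = λ {x} {y} {z} x≈y y≈z → ≤-antisym {x} {z}
      (≤-trans {x} {y} {z} (≤-reflexive {x} {y} x≈y) (≤-reflexive {y} {z} y≈z))
      (≤-trans {z} {y} {x} (≤-reflexive {z} {y} (≈-sym {y} {z} y≈z))
                           (≤-reflexive {y} {x} (≈-sym {x} {y} x≈y)))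
  }

≈-setoid : Setoid 0ℓ 0ℓ
≈-setoid = record { isEquivalence = ≈-isEquivalence }

≤-isPartialOrder : IsPartialOrder _≈_ _≤_
≤-isPartialOrder = record
  { isPreorder = record
    { isEquivalence = ≈-isEquivalence
    ; reflexive     = λ {x} {y} → ≤-reflexive {x} {y}
    ; trans         = λ {x} {y} {z} → ≤-trans {x} {y} {z}
    }
  ; antisym = λ {x} {y} → ≤-antisym {x} {y}
  }

+-mono-≤ : ∀ {x y z w} → x ≤ y → z ≤ w → x + z ≤ y + w
+-mono-≤ {x} {y} {z} {w} x≤y z≤w n = begin
  (p ℚ.+ r) ℚ.- (q ℚ.+ s)
    ≡⟨ solve 4 (λ p q r s → (p :+ r) :- (q :+ s) := (p :- q) :+ (r :- s)) ≡.refl p q r s ⟩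
  (p ℚ.- q) ℚ.+ (r ℚ.- s)
    ≤⟨ ℚ.+-mono-≤ (x≤y (odd n)) (z≤w (odd n)) ⟩
  (ε (odd n) ℚ.+ ε (odd n)) ℚ.+ (ε (odd n) ℚ.+ ε (odd n))
    ≡⟨ ≡.cong₂ ℚ._+_ (ε-odd n) (ε-odd n) ⟩
  ε n ℚ.+ ε n ∎
  where
  open ℚ.≤-Reasoning
  open +-*-Solver
  p = seq x (odd n)
  q = seq y (odd n)
  r = seq z (odd n)
  s = seq w (odd n)

+-comm : ∀ x y → x + y ≈ y + x
+-comm x y = seq-≡⇒≈ {x + y} {y + x} λ n → ℚ.+-comm (seq x (odd n)) (seq y (odd n))

+-identityˡ : ∀ x → 0ℝ + x ≈ x
+-identityˡ x n = begin
  ∣ (0ℚ ℚ.+ seq x (odd n)) ℚ.- seq x n ∣    ≡⟨ ≡.cong (λ p → ∣ p ℚ.- seq x n ∣) (ℚ.+-identityˡ (seq x (odd n))) ⟩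
  ∣ seq x (odd n) ℚ.- seq x n ∣             ≤⟨ regular x (odd n) n ⟩
  ε (odd n) ℚ.+ ε n                         ≤⟨ ℚ.+-monoˡ-≤ (ε n) (ε-odd≤ε n) ⟩
  ε n ℚ.+ ε n                               ∎
  where open ℚ.≤-Reasoning

+-inverseˡ : ∀ x → - x + x ≈ 0ℝ
+-inverseˡ x = seq-≡⇒≈ { - x + x} {0ℝ} λ n → ℚ.+-inverseˡ (seq x (odd n))

-‿cong : ∀ {x y} → x ≈ y → - x ≈ - y
-‿cong {x} {y} x≈y n = ≡.subst (ℚ._≤ ε n ℚ.+ ε n) (≡.sym ∣-p+q∣≡∣p-q∣) (x≈y n)
  where
  open +-*-Solver
  ∣-p+q∣≡∣p-q∣ : ∣ ℚ.- seq x n ℚ.- ℚ.- seq y n ∣ ≡ ∣ seq x n ℚ.- seq y n ∣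
  ∣-p+q∣≡∣p-q∣ = ≡.trans
    (≡.cong ∣_∣ (solve 2 (λ p q → (:- p) :- (:- q) := :- (p :- q)) ≡.refl (seq x n) (seq y n)))
    (ℚ.∣-p∣≡∣p∣ (seq x n ℚ.- seq y n))

+-assoc : ∀ x y z → (x + y) + z ≈ x + (y + z)
+-assoc x y z n = begin
  ∣ ((p′ ℚ.+ q) ℚ.+ r) ℚ.- (p ℚ.+ (q ℚ.+ r′)) ∣
    ≡⟨ ≡.cong ∣_∣ (solve 5 (λ p p′ q r r′ → ((p′ :+ q) :+ r) :- (p :+ (q :+ r′)) := (p′ :- p) :+ (r :- r′))
         ≡.refl p p′ q r r′) ⟩
  ∣ (p′ ℚ.- p) ℚ.+ (r ℚ.- r′) ∣
    ≤⟨ ℚ.∣p+q∣≤∣p∣+∣q∣ (p′ ℚ.- p) (r ℚ.- r′) ⟩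
  ∣ p′ ℚ.- p ∣ ℚ.+ ∣ r ℚ.- r′ ∣
    ≤⟨ ℚ.+-mono-≤ (regular x (odd (odd n)) (odd n)) (regular z (odd n) (odd (odd n))) ⟩
  (ε (odd (odd n)) ℚ.+ ε (odd n)) ℚ.+ (ε (odd n) ℚ.+ ε (odd (odd n)))
    ≤⟨ ℚ.+-mono-≤ (ℚ.+-monoˡ-≤ (ε (odd n)) (ε-odd≤ε (odd n)))
                  (ℚ.+-monoʳ-≤ (ε (odd n)) (ε-odd≤ε (odd n))) ⟩
  (ε (odd n) ℚ.+ ε (odd n)) ℚ.+ (ε (odd n) ℚ.+ ε (odd n))
    ≡⟨ ≡.cong₂ ℚ._+_ (ε-odd n) (ε-odd n) ⟩
  ε n ℚ.+ ε n ∎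
  where
  open ℚ.≤-Reasoning
  open +-*-Solver
  p = seq x (odd n)
  p′ = seq x (odd (odd n))
  q = seq y (odd (odd n))
  r = seq z (odd n)
  r′ = seq z (odd (odd n))

<⇒≤ : ∀ {x y} → x < y → x ≤ y
<⇒≤ {x} {y} (n , gap) m = begin
  seq x m ℚ.- seq y m
    ≡⟨ solve 4 (λ p p′ q q′ → p :- q := ((p :- p′) :+ (q′ :- q)) :- (q′ :- p′)) ≡.refl
         (seq x m) (seq x n) (seq y m) (seq y n) ⟩
  ((seq x m ℚ.- seq x n) ℚ.+ (seq y n ℚ.- seq y m)) ℚ.- (seq y n ℚ.- seq x n)
    ≤⟨ ℚ.+-mono-≤ (ℚ.+-mono-≤ (seq-upper x m n) (seq-upper y n m))
                  (ℚ.neg-antimono-≤ (ℚ.<⇒≤ gap)) ⟩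
  ((ε m ℚ.+ ε n) ℚ.+ (ε n ℚ.+ ε m)) ℚ.- (ε n ℚ.+ ε n)
    ≡⟨ solve 2 (λ d e → ((d :+ e) :+ (e :+ d)) :- (e :+ e) := d :+ d) ≡.refl (ε m) (ε n) ⟩
  ε m ℚ.+ ε m ∎
  where
  open ℚ.≤-Reasoning
  open +-*-Solver

seq-≤⇒≤ : ∀ {x y} → (∀ n → seq x n ℚ.≤ seq y n) → x ≤ y
seq-≤⇒≤ {x} {y} x≤y n = begin
  seq x n ℚ.- seq y n    ≤⟨ ℚ.+-monoˡ-≤ (ℚ.- seq y n) (x≤y n) ⟩
  seq y n ℚ.- seq y n    ≡⟨ ℚ.+-inverseʳ (seq y n) ⟩
  0ℚ                     ≤⟨ 0≤ε+ε n ⟩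
  ε n ℚ.+ ε n            ∎
  where open ℚ.≤-Reasoning

⊓-glb : ∀ {x y z} → z ≤ x → z ≤ y → z ≤ x ⊓ y
⊓-glb {x} {y} {z} z≤x z≤y n with ℚ.⊓-sel (seq x n) (seq y n)
... | inj₁ eq = ≡.subst (λ p → seq z n ℚ.- p ℚ.≤ ε n ℚ.+ ε n) (≡.sym eq) (z≤x n)
... | inj₂ eq = ≡.subst (λ p → seq z n ℚ.- p ℚ.≤ ε n ℚ.+ ε n) (≡.sym eq) (z≤y n)

⊓-infimum : Infimum _≤_ _⊓_
⊓-infimum x y =
  seq-≤⇒≤ {x ⊓ y} {x} (λ n → ℚ.p⊓q≤p (seq x n) (seq y n)) ,
  seq-≤⇒≤ {x ⊓ y} {y} (λ n → ℚ.p⊓q≤q (seq x n) (seq y n)) ,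
  λ z → ⊓-glb {x} {y} {z}

+-0-abelianGroup : AbelianGroup 0ℓ 0ℓ
+-0-abelianGroup = record
  { Carrier = ℝ
  ; _≈_     = _≈_
  ; _∙_     = _+_
  ; ε       = 0ℝ
  ; _⁻¹     = -_
  ; isAbelianGroup = record
    { isGroup = record
      { isMonoid = record
        { isSemigroup = record
          { isMagma = record
            { isEquivalence = ≈-isEquivalence
            ; ∙-cong        = λ {x} {y} {z} {w} x≈y z≈w → ≤-antisym {x + z} {y + w}
                (+-mono-≤ {x} {y} {z} {w} (≤-reflexive {x} {y} x≈y) (≤-reflexive {z} {w} z≈w))
                (+-mono-≤ {y} {x} {w} {z} (≤-reflexive {y} {x} (≈-sym {x} {y} x≈y))
                                          (≤-reflexive {w} {z} (≈-sym {z} {w} z≈w)))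
            }
          ; assoc = +-assoc
          }
        ; identity = comm∧idˡ⇒id {_∙_ = _+_} +-comm {e = 0ℝ} +-identityˡ
        }
      ; inverse = comm∧invˡ⇒inv {_∙_ = _+_} {_⁻¹ = -_} {e = 0ℝ} +-comm +-inverseˡ
      ; ⁻¹-cong = λ {x} {y} → -‿cong {x} {y}
      }
    ; comm = +-comm
    }
  }
  where open Consequences ≈-setoid

orderedAbelianGroup : OrderedAbelianGroup 0ℓ 0ℓ 0ℓ
orderedAbelianGroup = record
  { abelianGroup   = +-0-abelianGroup
  ; _≤_            = _≤_
  ; isPartialOrder = ≤-isPartialOrder
  ; +-mono-≤       = λ {x} {y} {z} {w} → +-mono-≤ {x} {y} {z} {w}
  }

open Sorted (OrderedAbelianGroup.poset orderedAbelianGroup) using (successive⇒monotone; ≤-foldr⇔)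
open OrderedGroup orderedAbelianGroup
  using (x-y≤z⇔x≤y+z; z≤x-y⇔y+z≤x; ∑upper≤∑lower+ng; tight⇒separated; separated⇒tight)

≤-minimum⇔ : ∀ z (v : Vector ℝ (suc n)) → (z ≤ minimum v) ⇔ (∀ i → z ≤ v i)
≤-minimum⇔ z v = mk⇔
  (λ z≤min → let z≤v₀ , z≤vₛ = to z≤min in λ { zero → z≤v₀ ; (suc i) → z≤vₛ i })
  (λ z≤v → from (z≤v zero , z≤v ∘ suc))
  where open Equivalence (≤-foldr⇔ {_⊓_} ⊓-infimum {z = z} {w = head v} (tail v))

lemma1 : (n : ℕ) (n≥2 : 2 ℕ.≤ n) (x : Vector ℝ n) (g : ℝ) → Ascending x → 0ℝ < g →
    (π : Permutation′ (n ℕ.* 2)) →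
    let b = rearrange (π ⟨$⟩ʳ_) (interleave x g)
        R = sum (evenEntries n b)
        U = sum (oddEntries n b)
        G = minGap n≥2 x
    in Ascending b → (R - U ≤ n · g) × ((R - U ≈ n · g) ⇔ (G ≥ g))
lemma1 n@(suc (suc _)) (s≤s (s≤s _)) x g x-ascending 0<g π b-ascending =
  R-U≤ng , mk⇔
    (λ R-U≈ng → Equivalence.from (≤-minimum⇔ g gaps) λ k →
      Equivalence.from (z≤x-y⇔y+z≤x (x (suc k)) (x (inject₁ k)) g)
        (tight⇒separated x x-mono 0≤g π b-mono
          (Equivalence.to (z≤x-y⇔y+z≤x R U (n · g)) (≤-reflexive {n · g} {R - U} (≈-sym {R - U} {n · g} R-U≈ng))) k))
    (λ g≤G → ≤-antisym {R - U} {n · g} R-U≤ng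
      (Equivalence.from (z≤x-y⇔y+z≤x R U (n · g)) (separated⇒tight x x-mono 0≤g π b-mono λ k →
        Equivalence.to (z≤x-y⇔y+z≤x (x (suc k)) (x (inject₁ k)) g) (Equivalence.to (≤-minimum⇔ g gaps) g≤G k))))
  where
  b = rearrange (π ⟨$⟩ʳ_) (interleave x g)
  R = sum (evenEntries n b)
  U = sum (oddEntries n b)
  gaps = λ k → x (suc k) - x (inject₁ k)
  x-mono = λ {i j} → successive⇒monotone x x-ascending {i} {j}
  b-mono = λ {i j} → successive⇒monotone b b-ascending {i} {j}
  0≤g = <⇒≤ {0ℝ} {g} 0<g

  R-U≤ng : R - U ≤ n · g
  R-U≤ng = Equivalence.from (x-y≤z⇔x≤y+z R U (n · g)) (∑upper≤∑lower+ng x x-mono 0≤g π b-mono)
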